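{- Let $k \in \{3,4,5\}$. Set $v_1 = k^2 - k + 1$ and $v_j = k(k-1)\prod_{i=1}^{j-1} v_i + 1$ for $j > 1$, and let $H_i(k)$ be an $S(2,k,v_i)$-system for all $i \geq 1$. Define $$S_1(k) = K_k, \qquad S_{i+1}(k) = \Gamma(S_i(k), H_i(k)) \quad (i \geq 1).$$ Then $S_t(k)$ is a connected graph of order $n_t = k\prod_{i=1}^{t-1} v_i$ and constant link $tK_{k-1}$, for any $t \geq 1$. Moreover, $S_t(3)$ is $\{C_4, C_5\}$-free, and $S_t(4)$ is $C_5$-free, for every $t \geq 1$.
   Context: All graphs are finite and simple; order means number of vertices. A graph $G$ has constant link $L$ if for every vertex $v$ the subgraph induced by the open neighborhood $N(v)$ is isomorphic to $L$; $tL$ is the disjoint union of $t$ copies of $L$. "$C_\ell$-free" means containing no cycle of length $\ell$ as a (not necessarily induced) subgraph. A Steiner system $S(2,k,v)$ is a pair $(V,B)$ where $V$ is a set of $v$ points and $B$ is a family of $k$-element subsets of $V$ (blocks) such that each $2$-element subset of $V$ is contained in exactly one block. It is regarded as a $k$-uniform $\frac{v-1}{k-1}$-regular hypergraph with vertex set $V$ and edge set $B$. (For $k\in\{3,4,5\}$ an $S(2,k,v)$ is known to exist for every $v\equiv 1 \pmod{k(k-1)}$, $v>1$.) Construction of $\Gamma(G,H)$ (with the clique $K_k$): let $G$ be a graph of order $n$ and constant link $sK_{k-1}$ for some $s\ge1$, and $H$ an $n$-regular $k$-uniform hypergraph (every vertex in exactly $n$ edges, every edge of size $k$) with vertices $x_1,\dots,x_N$.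 (1) At each vertex $x$ of $H$ enumerate the hyperedges containing $x$ as $E_{x,1},\dots,E_{x,n}$. (2) Take $N$ disjoint copies of $G$ on vertex sets $V_1,\dots,V_N$, $V_i=\{v_{i,1},\dots,v_{i,n}\}$, and set $V(\Gamma)=V_1\cup\dots\cup V_N$. (3) With each edge $E$ of $H$ associate the $k$-element set $f(E)\subseteq V(\Gamma)$ defined by $v_{i,j}\in f(E)$ if and only if $E_{x_i,j}=E$. (4) For each hyperedge $E$ of $H$, place a copy of $K_k$ on the set $f(E)$. The resulting graph (for any choice of the enumerations) is $\Gamma(G,H)$. -}

module Defs where

open import Data.Nat.Base using (ℕ; zero; suc; _+_; _*_; _∸_; _^_; NonZero)
open import Data.Nat.DivMod using (_mod_)
open import Data.Fin.Base using (Fin; toℕ)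
open import Data.Fin.Properties using (_≟_; any?)
open import Data.Fin.Subset using (Subset; _∈_; ∣_∣)
open import Data.Product.Base using (∃-syntax; _×_; _,_)
open import Data.Product.Properties using (≡-dec)
open import Data.Refinement.Base using (Refinement; value)
open import Data.Sum.Base using (_⊎_; inj₁; inj₂)
open import Function.Bundles using (_↔_; _⇔_; Inverse)
open import Function.Definitions using (Injective)
open import Function.Properties.Inverse using (↔⇒↣)
open import Relation.Binary.Construct.Closure.ReflexiveTransitive using (Star)
open import Relation.Binary.Definitions using (Decidable; DecidableEquality; Irreflexive; Symmetric)
open import Relation.Binary.PropositionalEquality using (_≡_; _≢_; refl; sym; ≢-sym)
open import Relation.Nullary.Decidable using (¬?; _×-dec_; _⊎-dec_; via-injection)
open import Relation.Nullary.Negation using (¬_)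
open import Relation.Unary using (Pred)
open import Level using (0ℓ)

-- Simple graphs.  Finiteness is expressed separately by HasOrder.

record Graph : Set₁ where
  field
    V          : Set
    Adj        : V → V → Set
    adj?       : Decidable Adj
    adj-sym    : Symmetric Adj
    adj-irrefl : Irreflexive _≡_ Adj

open Graph public

-- A numbering of the vertices by Fin n.
HasOrder : Graph → ℕ → Set
HasOrder G n = V G ↔ Fin n

record _≅_ (G H : Graph) : Set where
  field
    vertices : V G ↔ V H
    adjacent : ∀ x y → Adj G x y ⇔ Adj H (Inverse.to vertices x) (Inverse.to vertices y)

K : ℕ → Graph
K n = record
  { V          = Fin n
  ; Adj        = _≢_
  ; adj?       = λ x y → ¬? (x ≟ y)
  ; adj-sym    = ≢-sym
  ; adj-irrefl = λ x≡y x≢y → x≢y x≡y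
  }

infixr 7 _⊙_

-- t ⊙ L is the disjoint union of t copies of L.
_⊙_ : ℕ → Graph → Graph
t ⊙ L = record
  { V          = Fin t × V L
  ; Adj        = λ (i , x) (j , y) → i ≡ j × Adj L x y
  ; adj?       = λ (i , x) (j , y) → (i ≟ j) ×-dec adj? L x y
  ; adj-sym    = λ (i≡j , a) → sym i≡j , adj-sym L a
  ; adj-irrefl = λ { refl (_ , a) → adj-irrefl L refl a }
  }

-- Vertices of an induced subgraph carry an irrelevant membership proof, so
-- they are equal as soon as the underlying vertices of G are.
induced : (G : Graph) → Pred (V G) 0ℓ → Graph
induced G P = record
  { V          = Refinement (V G) P
  ; Adj        = λ x y → Adj G (value x) (value y)
  ; adj?       = λ x y → adj? G (value x) (value y)
  ; adj-sym    = adj-sym G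
  ; adj-irrefl = λ { refl a → adj-irrefl G refl a }
  }

link : (G : Graph) → V G → Graph
link G v = induced G (Adj G v)

HasConstantLink : Graph → Graph → Set
HasConstantLink G L = ∀ v → link G v ≅ L

Connected : Graph → Set
Connected G = V G × (∀ x y → Star (Adj G) x y)

-- A (not necessarily induced) cycle of length ℓ; meant for ℓ ≥ 3.
record Cycle (G : Graph) (ℓ : ℕ) .{{_ : NonZero ℓ}} : Set where
  field
    vertex    : Fin ℓ → V G
    injective : Injective _≡_ _≡_ vertex
    adjacent  : ∀ i → Adj G (vertex i) (vertex (suc (toℕ i) mod ℓ))

CycleFree : (ℓ : ℕ) .{{_ : NonZero ℓ}} → Graph → Set
CycleFree ℓ G = ¬ Cycle G ℓ

-- The edges form a set of subsets of Fin N, listed without repetition.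
record Hypergraph (N : ℕ) : Set where
  field
    size           : ℕ
    edge           : Fin size → Subset N
    edge-injective : Injective _≡_ _≡_ edge

open Hypergraph public

-- S(2,k,v)
record SteinerSystem (k v : ℕ) : Set where
  field
    hypergraph : Hypergraph v
    uniform    : ∀ e → ∣ edge hypergraph e ∣ ≡ k
    covered    : ∀ {x y} → x ≢ y → ∃[ e ] (x ∈ edge hypergraph e × y ∈ edge hypergraph e)
    unique     : ∀ {x y} → x ≢ y → ∀ {e e′} →
                 x ∈ edge hypergraph e → y ∈ edge hypergraph e →
                 x ∈ edge hypergraph e′ → y ∈ edge hypergraph e′ → e ≡ e′

open SteinerSystem public

-- For every vertex x, a listing E x 1, …, E x n without repetition of all the
-- edges containing x.  One exists exactly when the hypergraph is n-regular.
record Enumeration {N : ℕ} (H : Hypergraph N) (n : ℕ) : Set where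
  field
    E           : Fin N → Fin n → Fin (size H)
    E-injective : ∀ x → Injective _≡_ _≡_ (E x)
    E-sound     : ∀ x j → x ∈ edge H (E x j)
    E-complete  : ∀ x e → x ∈ edge H e → ∃[ j ] E x j ≡ e

-- The vertex (i , w) is the copy v_{i,j} of w in V_i, where j is the number of
-- w in the given numbering of V G.
module _ {N n : ℕ} (G : Graph) (numbering : HasOrder G n)
         (H : Hypergraph N) (enum : Enumeration H n) where

  open Enumeration enum

  private
    ΓV : Set
    ΓV = Fin N × V G

    _≟ᵛ_ : DecidableEquality ΓV
    _≟ᵛ_ = ≡-dec _≟_ (via-injection (↔⇒↣ numbering) _≟_)

  f : Fin (size H) → Pred ΓV 0ℓ
  f e (i , w) = E i (Inverse.to numbering w) ≡ e

  Γ : Graph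
  Γ = record
    { V          = ΓV
    ; Adj        = λ p q → InCopy p q ⊎ InClique p q
    ; adj?       = λ p q → inCopy? p q ⊎-dec inClique? p q
    ; adj-sym    = λ { (inj₁ (i≡j , a))           → inj₁ (sym i≡j , adj-sym G a)
                     ; (inj₂ (p≢q , e , p∈ , q∈)) → inj₂ (≢-sym p≢q , e , q∈ , p∈) }
    ; adj-irrefl = λ { refl (inj₁ (_ , a))   → adj-irrefl G refl a
                     ; refl (inj₂ (p≢p , _)) → p≢p refl }
    }
    where
    InCopy InClique : ΓV → ΓV → Set
    InCopy   (i , w) (j , w′) = i ≡ j × Adj G w w′
    InClique p q              = p ≢ q × ∃[ e ] (f e p × f e q)

    inCopy? : Decidable InCopy
    inCopy? (i , w) (j , w′) = (i ≟ j) ×-dec adj? G w w′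

    inClique? : Decidable InClique
    inClique? p q = ¬? (p ≟ᵛ q) ×-dec any? (λ e → (_ ≟ e) ×-dec (_ ≟ e))

-- v k j is v_j and ∏v k m is v_1 ⋯ v_m.  The value v k 0 is never used.
mutual
  v : ℕ → ℕ → ℕ
  v k 0             = 0
  v k 1             = k ^ 2 ∸ k + 1
  v k (suc (suc j)) = k * (k ∸ 1) * ∏v k (suc j) + 1

  ∏v : ℕ → ℕ → ℕ
  ∏v k zero    = 1
  ∏v k (suc m) = ∏v k m * v k (suc m)

-- IsS k H t G says that G is a graph S_t(k), for the systems H_i(k) = H i and
-- some choice of numberings and enumerations at each application of Γ.
data IsS (k : ℕ) (H : (i : ℕ) .{{_ : NonZero i}} → SteinerSystem k (v k i)) : ℕ → Graph → Set₁ where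
  base : IsS k H 1 (K k)
  step : ∀ {i n G} → IsS k H (suc i) G →
         (numbering : HasOrder G n) (enum : Enumeration (hypergraph (H (suc i))) n) →
         IsS k H (suc (suc i)) (Γ G numbering (hypergraph (H (suc i))) enum)

{-# OPTIONS --safe #-}
-- A vertex (i , w) of Γ(G,H) is determined by the point i and the block f(E)
-- through it, so the vertices of Γ are the flags of H, and adjacent vertices
-- share their point (edges of a copy of G) or their block (clique edges), but
-- not both.  Since two blocks share at most one point, the incidence graph of H
-- has no 4-cycle.  Hence the link of a vertex gains exactly one component
-- K_{k-1}, and a cycle of Γ that is neither in a copy of G nor in a clique has
-- at least three edges of each kind, that is length at least 6.
module Submission where

open import Defs
open import Data.Bool.Base using (true; false)
open import Data.Fin.Base using (Fin; zero; suc; toℕ; punchIn; punchOut)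
open import Data.Fin.Patterns using (0F; 1F; 2F; 3F; 4F)
open import Data.Fin.Properties
  using (_≟_; suc-injective; punchIn-injective; punchInᵢ≢i; punchIn-punchOut;
         injective⇒≤; cantor-schröder-bernstein; *↔×)
open import Data.Fin.Subset using (Subset; _∈_; ∣_∣)
open import Data.Irrelevant using ([_])
open import Data.Nat.Base using (ℕ; zero; suc; _+_; _*_; _∸_; _^_; _≤_; _<_; _≥_; z≤n; s≤s; NonZero)
open import Data.Nat.DivMod using (_mod_)
open import Data.Nat.Properties
  using (+-comm; *-assoc; *-comm; *-identityʳ; *-distribˡ-∸; *-cancelʳ-≡; <⇒≱; n<1+n)
open import Data.Product.Base using (_×_; ∃-syntax; _,_; proj₁; proj₂)
open import Data.Product.Function.NonDependent.Propositional using (_×-cong_)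
open import Data.Refinement.Base using (Refinement; _,_; value)
open import Data.Refinement.Properties using (value-injective)
open import Data.Sum.Base using (_⊎_; inj₁; inj₂; [_,_]′; swap)
open import Data.Vec.Base using ([]; _∷_; here; there; lookup; tabulate)
open import Data.Vec.Properties using (lookup∘tabulate; lookup⇒[]=; []=⇒lookup)
open import Function.Base using (_∘_)
open import Function.Bundles using (_↔_; _⇔_; mk↔ₛ′; mk⇔; Injection; Inverse; Equivalence)
open import Function.Construct.Composition using (_↔-∘_)
open import Function.Construct.Identity using (↔-id)
open import Function.Construct.Symmetry using (↔-sym)
open import Function.Definitions using (Injective)
open import Function.Properties.Inverse using (↔⇒↣)
open import Level using (0ℓ)
open import Relation.Binary.Construct.Closure.ReflexiveTransitive using (Star; ε; _◅_; _◅◅_; gmap)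
open import Relation.Binary.PropositionalEquality
  using (_≡_; _≢_; refl; sym; trans; cong; cong₂; subst; subst₂; module ≡-Reasoning)
open import Relation.Nullary.Decidable using (yes; no; recompute)
open import Relation.Nullary.Negation using (¬_; contradiction)
open import Relation.Unary using (Pred; Decidable; _⊆_)

-- Enumerations of predicates

-- In effect a bijection from `I` onto the elements satisfying `P`, stated on `X` itself so that no
-- membership proofs have to be compared.
record Listing {X : Set} (I : Set) (P : Pred X 0ℓ) : Set where
  field
    at           : I → X
    at-injective : Injective _≡_ _≡_ at
    at-sound     : ∀ i → P (at i)
    at-complete  : ∀ {x} → P x → ∃[ i ] at i ≡ x

open Listing

module _ {X : Set} {P : Pred X 0ℓ} where

  map-Listing : ∀ {I} {Q : Pred X 0ℓ} → P ⊆ Q → Q ⊆ P → Listing I P → Listing I Q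
  map-Listing P⊆Q Q⊆P L = record
    { at           = at L
    ; at-injective = at-injective L
    ; at-sound     = P⊆Q ∘ at-sound L
    ; at-complete  = at-complete L ∘ Q⊆P
    }

  without : ∀ {n x} → P x → Listing (Fin (suc n)) P → Listing (Fin n) (λ y → P y × y ≢ x)
  without {n} {x} px L with at-complete L px
  ... | i , refl = record
    { at           = at L ∘ punchIn i
    ; at-injective = punchIn-injective i _ _ ∘ at-injective L
    ; at-sound     = λ j → at-sound L _ , punchInᵢ≢i i j ∘ at-injective L
    ; at-complete  = complete
    }
    where
    complete : ∀ {y} → P y × y ≢ at L i → ∃[ j ] at L (punchIn i j) ≡ y
    complete (py , y≢x) with at-complete L py
    ... | j , refl = punchOut i≢j , cong (at L) (punchIn-punchOut i≢j)
      where
      i≢j : i ≢ j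
      i≢j i≡j = y≢x (cong (at L) (sym i≡j))

  relabel : ∀ {I J} → Listing I P → Listing J P → I → J
  relabel L M i = proj₁ (at-complete M (at-sound L i))

  relabel-injective : ∀ {I J} (L : Listing I P) (M : Listing J P) → Injective _≡_ _≡_ (relabel L M)
  relabel-injective L M {i} {j} eq = at-injective L
    (trans (sym (proj₂ (at-complete M (at-sound L i))))
      (trans (cong (at M) eq) (proj₂ (at-complete M (at-sound L j)))))

  Listing-unique : ∀ {m n} → Listing (Fin m) P → Listing (Fin n) P → m ≡ n
  Listing-unique L M = cantor-schröder-bernstein (relabel-injective L M) (relabel-injective M L)

  reindex : ∀ {I J} → I ↔ J → Listing J P → Listing I P
  reindex {I} {J} I↔J L = record
    { at           = at L ∘ to
    ; at-injective = λ eq → Injection.injective (↔⇒↣ I↔J) (at-injective L eq)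
    ; at-sound     = at-sound L ∘ to
    ; at-complete  = λ px → let j , eq = at-complete L px in
                            from j , trans (cong (at L) (strictlyInverseˡ j)) eq
    }
    where open Inverse I↔J

  -- The membership proof inside a `Refinement` is irrelevant, so decidability of `P` is what makes
  -- it available to `at-complete`.
  Listing⇒↔ : ∀ {I} → Decidable P → Listing I P → Refinement X P ↔ I
  Listing⇒↔ {I} P? L = mk↔ₛ′
    (λ { (x , [ px ]) → proj₁ (at-complete L (recompute (P? x) px)) })
    (λ i → at L i , [ at-sound L i ])
    (λ i → at-injective L (proj₂ (at-complete L _)))
    (λ { (x , [ px ]) → value-injective (proj₂ (at-complete L (recompute (P? x) px))) })

Listing-Subset : ∀ {n} (p : Subset n) → Listing (Fin ∣ p ∣) (_∈ p)
Listing-Subset [] = record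
  { at = λ () ; at-injective = λ { {()} } ; at-sound = λ () ; at-complete = λ () }
Listing-Subset (true ∷ p) = record
  { at           = λ { zero → zero ; (suc i) → suc (at L i) }
  ; at-injective = λ { {zero}  {zero}  _  → refl
                     ; {suc i} {suc j} eq → cong suc (at-injective L (suc-injective eq)) }
  ; at-sound     = λ { zero → here ; (suc i) → there (at-sound L i) }
  ; at-complete  = λ { here       → zero , refl
                     ; (there x∈) → let i , eq = at-complete L x∈ in suc i , cong suc eq }
  }
  where L = Listing-Subset p
Listing-Subset (false ∷ p) = record
  { at           = suc ∘ at L
  ; at-injective = at-injective L ∘ suc-injective
  ; at-sound     = there ∘ at-sound L
  ; at-complete  = λ { (there x∈) → let i , eq = at-complete L x∈ in i , cong suc eq }
  }
  where L = Listing-Subset p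

Listing-Fin : ∀ n (x : Fin (suc n)) → Listing (Fin n) (_≢ x)
Listing-Fin n x = record
  { at           = punchIn x
  ; at-injective = punchIn-injective x _ _
  ; at-sound     = punchInᵢ≢i x
  ; at-complete  = λ y≢x → punchOut (y≢x ∘ sym) , punchIn-punchOut (y≢x ∘ sym)
  }

-- Steiner systems and their regularity

module Steiner {k N} (S : SteinerSystem k N) where

  H : Hypergraph N
  H = hypergraph S

  Listing-edge : ∀ e → Listing (Fin k) (_∈ edge H e)
  Listing-edge e = subst (λ n → Listing (Fin n) (_∈ edge H e)) (uniform S e) (Listing-Subset (edge H e))

  module _ (x : Fin N) where

    -- The row of the incidence matrix at `x`; as a `Subset` of edge indices it can be listed by
    -- `Listing-Subset`.
    edgesAt : Subset (size H)
    edgesAt = tabulate (λ e → lookup (edge H e) x)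

    Listing-edgesAt : Listing (Fin ∣ edgesAt ∣) (λ e → x ∈ edge H e)
    Listing-edgesAt = map-Listing
      (λ {e} e∈ → lookup⇒[]= x (edge H e)
        (trans (sym (lookup∘tabulate (λ e → lookup (edge H e) x) e)) ([]=⇒lookup e∈)))
      (λ {e} x∈ → lookup⇒[]= e edgesAt
        (trans (lookup∘tabulate (λ e → lookup (edge H e) x) e) ([]=⇒lookup x∈)))
      (Listing-Subset edgesAt)

-- Every y ≢ x lies together with x in exactly one edge.
Listing-rest : ∀ {m N} (S : SteinerSystem (suc m) N) (x : Fin N) →
               Listing (Fin ∣ Steiner.edgesAt S x ∣ × Fin m) (_≢ x)
Listing-rest {m} S x = record
  { at           = λ (i , j) → at (rest i) j
  ; at-injective = injective
  ; at-sound     = λ (i , j) → proj₂ (at-sound (rest i) j)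
  ; at-complete  = complete
  }
  where
  open Steiner S

  edges : Listing (Fin ∣ edgesAt x ∣) (λ e → x ∈ edge H e)
  edges = Listing-edgesAt x

  rest : ∀ i → Listing (Fin m) (λ y → y ∈ edge H (at edges i) × y ≢ x)
  rest i = without (at-sound edges i) (Listing-edge (at edges i))

  injective : Injective _≡_ _≡_ (λ (i , j) → at (rest i) j)
  injective {i , j} {i′ , j′} eq with at-sound (rest i) j | at-sound (rest i′) j′
  ... | y∈e , y≢x | y′∈e′ , _
    -- Both edges contain `x` and the common point different from `x`, hence they coincide.
    with at-injective edges (unique S y≢x y∈e (at-sound edges i)
           (subst (_∈ edge H (at edges i′)) (sym eq) y′∈e′) (at-sound edges i′))
  ... | refl = cong (i ,_) (at-injective (rest i) eq)

  complete : ∀ {y} → y ≢ x → ∃[ ij ] at (rest (proj₁ ij)) (proj₂ ij) ≡ y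
  complete y≢x with covered S y≢x
  ... | e , y∈e , x∈e with at-complete edges x∈e
  ... | i , refl with at-complete (rest i) (y∈e , y≢x)
  ... | j , eq = (i , j) , eq

-- Counting the points other than `x` edge by edge gives degree times `suc m`; counting them
-- directly gives `n * suc m`. So every point has degree `n`.
enumeration : ∀ {m n N} → N ≡ suc (n * suc m) → (S : SteinerSystem (suc (suc m)) N) →
              Enumeration (hypergraph S) n
enumeration {m} {n} refl S = record
  { E           = λ x → at (edges x)
  ; E-injective = λ x → at-injective (edges x)
  ; E-sound     = λ x → at-sound (edges x)
  ; E-complete  = λ x e → at-complete (edges x)
  }
  where
  open Steiner S

  degree : ∀ x → ∣ edgesAt x ∣ ≡ n
  degree x = *-cancelʳ-≡ _ n (suc m)
    (Listing-unique (reindex *↔× (Listing-rest S x)) (Listing-Fin (n * suc m) x))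

  edges : ∀ x → Listing (Fin n) (λ e → x ∈ edge H e)
  edges x = subst (λ r → Listing (Fin r) (λ e → x ∈ edge H e)) (degree x) (Listing-edgesAt x)

-- Links, and the base case of complete graphs

-- Like an isomorphism link G v ≅ L, but free of irrelevant proofs.
record LinkListing (G : Graph) (v : V G) (L : Graph) : Set where
  field
    listing  : Listing (V L) (Adj G v)
    adjacent : ∀ p q → Adj G (at listing p) (at listing q) ⇔ Adj L p q

open LinkListing

LinkListing⇒≅ : ∀ {G v L} → LinkListing G v L → link G v ≅ L
LinkListing⇒≅ {G} {v} {L} ℒ = record
  { vertices = vertices
  ; adjacent = λ x y →
      -- `adjacent ℒ` speaks of listed vertices only; `x` and `y` are replaced by the listed
      -- vertices that they equal.
      subst₂ (λ x′ y′ → Adj G (value x′) (value y′) ⇔ Adj L (to x) (to y))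
        (strictlyInverseʳ x) (strictlyInverseʳ y) (adjacent ℒ (to x) (to y))
  }
  where
  vertices : V (link G v) ↔ V L
  vertices = Listing⇒↔ (adj? G v) (listing ℒ)
  open Inverse vertices

K-link : ∀ m v → LinkListing (K (suc m)) v (1 ⊙ K m)
K-link m v = record
  { listing = record
      { at           = λ (_ , j) → punchIn v j
      ; at-injective = λ { {0F , i} {0F , j} eq → cong (0F ,_) (punchIn-injective v i j eq) }
      ; at-sound     = λ (_ , j) → punchInᵢ≢i v j ∘ sym
      ; at-complete  = λ v≢x → (0F , punchOut v≢x) , punchIn-punchOut v≢x
      }
  ; adjacent = λ { (0F , i) (0F , j) → mk⇔
      (λ ne → refl , ne ∘ cong (punchIn v))
      (λ (_ , ne) → ne ∘ punchIn-injective v i j) }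
  }

K-connected : ∀ m → Connected (K (suc m))
K-connected m = zero , path
  where
  path : ∀ x y → Star (Adj (K (suc m))) x y
  path x y with x ≟ y
  ... | yes refl = ε
  ... | no x≢y   = x≢y ◅ ε

K-cycleFree : ∀ {k} ℓ .{{_ : NonZero ℓ}} → k < ℓ → CycleFree ℓ (K k)
K-cycleFree ℓ k<ℓ C = <⇒≱ k<ℓ (injective⇒≤ (Cycle.injective C))

-- Flags and short closed walks

-- The axioms hold for the flags of a linear space and, unlike those of a linear
-- space, are symmetric in points and blocks.
record IsFlags {X A B : Set} (pt : X → A) (bl : X → B) : Set where
  field
    separated : ∀ x y → x ≢ y → pt x ≡ pt y → bl x ≢ bl y
    no-square : ∀ a b c d → a ≢ b → b ≢ c →
                pt a ≡ pt b → bl b ≡ bl c → pt c ≡ pt d → bl d ≢ bl a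

open IsFlags

-- The square is rotated by one corner, to start at `d`. This needs `d` and `a` distinct: otherwise
-- `b` and `c` would share both point and block.
dual : ∀ {X A B} {pt : X → A} {bl : X → B} → IsFlags pt bl → IsFlags bl pt
dual F = record
  { separated = λ x y x≢y b p → separated F x y x≢y p b
  ; no-square = λ a b c d a≢b b≢c bab pbc bcd pda →
      no-square F d a b c
        (λ { refl → separated F b c b≢c pbc (trans (sym bab) (sym bcd)) })
        a≢b pda bab pbc bcd
  }

restrict : ∀ {I X A B} {pt : X → A} {bl : X → B} (x : I → X) → Injective _≡_ _≡_ x →
           IsFlags pt bl → IsFlags (pt ∘ x) (bl ∘ x)
restrict x inj F = record
  { separated = λ i j i≢j → separated F (x i) (x j) (i≢j ∘ inj)
  ; no-square = λ a b c d a≢b b≢c → no-square F (x a) (x b) (x c) (x d) (a≢b ∘ inj) (b≢c ∘ inj)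
  }

Constant : ∀ {I A : Set} → (I → A) → Set
Constant f = ∀ i j → f i ≡ f j

ClosedWalk : ∀ {A B : Set} ℓ .{{_ : NonZero ℓ}} → (Fin ℓ → A) → (Fin ℓ → B) → Set
ClosedWalk ℓ pt bl = ∀ i → let j = suc (toℕ i) mod ℓ in pt i ≡ pt j ⊎ bl i ≡ bl j

-- The flags are indexed by `Fin ℓ` itself, since a cycle has distinct vertices. Distinctness of
-- concrete indices is then settled by `λ ()`.
MonochromaticWalks : (ℓ : ℕ) .{{_ : NonZero ℓ}} → Set₁
MonochromaticWalks ℓ = ∀ {A B : Set} {pt : Fin ℓ → A} {bl : Fin ℓ → B} →
                       IsFlags pt bl → ClosedWalk ℓ pt bl → Constant pt ⊎ Constant bl

constant : ∀ {I A : Set} {f : I → A} {a} → (∀ i → f i ≡ a) → Constant f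
constant h i j = trans (h i) (sym (h j))

-- In the walks below the first step keeps the point.  If another step does
-- not, merging equal consecutive steps leaves two or four alternating ones.
walk₄ : ∀ {A B : Set} {pt : Fin 4 → A} {bl : Fin 4 → B} → IsFlags pt bl →
        pt 0F ≡ pt 1F →
        pt 1F ≡ pt 2F ⊎ bl 1F ≡ bl 2F →
        pt 2F ≡ pt 3F ⊎ bl 2F ≡ bl 3F →
        pt 3F ≡ pt 0F ⊎ bl 3F ≡ bl 0F →
        Constant pt
walk₄ {pt = pt} F a = go
  where
  go : _ → _ → _ → Constant pt
  go (inj₁ b) (inj₁ c) (inj₁ d) = constant λ
    { 0F → trans a (trans b (trans c d)) ; 1F → trans b (trans c d) ; 2F → trans c d ; 3F → d }
  go (inj₁ b) (inj₁ c) (inj₂ d) = contradiction (sym d) (separated F 0F 3F (λ ()) (trans a (trans b c)))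
  go (inj₁ b) (inj₂ c) (inj₁ d) = contradiction c (separated F 2F 3F (λ ()) (sym (trans d (trans a b))))
  go (inj₁ b) (inj₂ c) (inj₂ d) = contradiction (sym (trans c d)) (separated F 0F 2F (λ ()) (trans a b))
  go (inj₂ b) (inj₁ c) (inj₁ d) = contradiction b (separated F 1F 2F (λ ()) (sym (trans c (trans d a))))
  -- The only fully alternating pattern. In every other mixed pattern two distinct flags share both
  -- point and block.
  go (inj₂ b) (inj₁ c) (inj₂ d) = contradiction d (no-square F 0F 1F 2F 3F (λ ()) (λ ()) a b c)
  go (inj₂ b) (inj₂ c) (inj₁ d) = contradiction (trans b c) (separated F 1F 3F (λ ()) (sym (trans d a)))
  go (inj₂ b) (inj₂ c) (inj₂ d) = contradiction (sym (trans b (trans c d))) (separated F 0F 1F (λ ()) a)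

walk₅ : ∀ {A B : Set} {pt : Fin 5 → A} {bl : Fin 5 → B} → IsFlags pt bl →
        pt 0F ≡ pt 1F →
        pt 1F ≡ pt 2F ⊎ bl 1F ≡ bl 2F →
        pt 2F ≡ pt 3F ⊎ bl 2F ≡ bl 3F →
        pt 3F ≡ pt 4F ⊎ bl 3F ≡ bl 4F →
        pt 4F ≡ pt 0F ⊎ bl 4F ≡ bl 0F →
        Constant pt
walk₅ {pt = pt} F a = go
  where
  go : _ → _ → _ → _ → Constant pt
  go (inj₁ b) (inj₁ c) (inj₁ d) (inj₁ e) = constant λ
    { 0F → trans a (trans b (trans c (trans d e))) ; 1F → trans b (trans c (trans d e))
    ; 2F → trans c (trans d e) ; 3F → trans d e ; 4F → e }
  go (inj₁ b) (inj₁ c) (inj₁ d) (inj₂ e) =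
    contradiction (sym e) (separated F 0F 4F (λ ()) (trans a (trans b (trans c d))))
  go (inj₁ b) (inj₁ c) (inj₂ d) (inj₁ e) =
    contradiction d (separated F 3F 4F (λ ()) (sym (trans e (trans a (trans b c)))))
  go (inj₁ b) (inj₁ c) (inj₂ d) (inj₂ e) =
    contradiction (sym (trans d e)) (separated F 0F 3F (λ ()) (trans a (trans b c)))
  go (inj₁ b) (inj₂ c) (inj₁ d) (inj₁ e) =
    contradiction c (separated F 2F 3F (λ ()) (sym (trans d (trans e (trans a b)))))
  -- Four runs in five steps, so exactly one run has length two; the flags where the runs meet are
  -- the corners of the square.
  go (inj₁ b) (inj₂ c) (inj₁ d) (inj₂ e) =
    contradiction e (no-square F 0F 2F 3F 4F (λ ()) (λ ()) (trans a b) c d)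
  go (inj₁ b) (inj₂ c) (inj₂ d) (inj₁ e) =
    contradiction (trans c d) (separated F 2F 4F (λ ()) (sym (trans e (trans a b))))
  go (inj₁ b) (inj₂ c) (inj₂ d) (inj₂ e) =
    contradiction (sym (trans c (trans d e))) (separated F 0F 2F (λ ()) (trans a b))
  go (inj₂ b) (inj₁ c) (inj₁ d) (inj₁ e) =
    contradiction b (separated F 1F 2F (λ ()) (sym (trans c (trans d (trans e a)))))
  go (inj₂ b) (inj₁ c) (inj₁ d) (inj₂ e) =
    contradiction e (no-square F 0F 1F 2F 4F (λ ()) (λ ()) a b (trans c d))
  -- Here the run of length two passes through `0F`, so the square starts at `4F`.
  go (inj₂ b) (inj₁ c) (inj₂ d) (inj₁ e) =
    contradiction d (no-square F 4F 1F 2F 3F (λ ()) (λ ()) (trans e a) b c)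
  go (inj₂ b) (inj₁ c) (inj₂ d) (inj₂ e) =
    contradiction (trans d e) (no-square F 0F 1F 2F 3F (λ ()) (λ ()) a b c)
  go (inj₂ b) (inj₂ c) (inj₁ d) (inj₁ e) =
    contradiction (trans b c) (separated F 1F 3F (λ ()) (sym (trans d (trans e a))))
  go (inj₂ b) (inj₂ c) (inj₁ d) (inj₂ e) =
    contradiction e (no-square F 0F 1F 3F 4F (λ ()) (λ ()) a (trans b c) d)
  go (inj₂ b) (inj₂ c) (inj₂ d) (inj₁ e) =
    contradiction (trans b (trans c d)) (separated F 1F 4F (λ ()) (sym (trans e a)))
  go (inj₂ b) (inj₂ c) (inj₂ d) (inj₂ e) =
    contradiction (sym (trans b (trans c (trans d e)))) (separated F 0F 1F (λ ()) a)

-- By duality the first step may be assumed to keep the point.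
monochromatic₄ : MonochromaticWalks 4
monochromatic₄ F w with w 0F
... | inj₁ a = inj₁ (walk₄ F a (w 1F) (w 2F) (w 3F))
... | inj₂ a = inj₂ (walk₄ (dual F) a (swap (w 1F)) (swap (w 2F)) (swap (w 3F)))

monochromatic₅ : MonochromaticWalks 5
monochromatic₅ F w with w 0F
... | inj₁ a = inj₁ (walk₅ F a (w 1F) (w 2F) (w 3F) (w 4F))
... | inj₂ a = inj₂ (walk₅ (dual F) a (swap (w 1F)) (swap (w 2F)) (swap (w 3F)) (swap (w 4F)))

-- Flags, connectedness, order and cycles of Γ(G,H)

module ΓProperties {k N n} (G : Graph) (numbering : HasOrder G n)
                   (S : SteinerSystem k N) (enum : Enumeration (hypergraph S) n) where

  open Steiner S
  open Enumeration enum
  open Inverse numbering using (to; from; strictlyInverseˡ)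

  Γ′ : Graph
  Γ′ = Γ G numbering H enum

  -- `f e p` unfolds to `block p ≡ e`, so the cliques placed in step (4) are the fibres of `block`.
  block : V Γ′ → Fin (size H)
  block (i , w) = E i (to w)

  block-sound : ∀ p → proj₁ p ∈ edge H (block p)
  block-sound (i , w) = E-sound i (to w)

  block-injective : ∀ {i w w′} → block (i , w) ≡ block (i , w′) → w ≡ w′
  block-injective {i} eq = Injection.injective (↔⇒↣ numbering) (E-injective i eq)

  flag : ∀ {i e} → i ∈ edge H e → ∃[ w ] block (i , w) ≡ e
  flag {i} {e} i∈e with E-complete i e i∈e
  ... | j , eq = from j , trans (cong (E i) (strictlyInverseˡ j)) eq

  isFlags : IsFlags proj₁ block
  isFlags = record { separated = separated′ ; no-square = no-square′ }
    where
    separated′ : ∀ p q → p ≢ q → proj₁ p ≡ proj₁ q → block p ≢ block q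
    separated′ (i , w) (i , w′) p≢q refl eq = p≢q (cong (i ,_) (block-injective eq))

    no-square′ : ∀ a b c d → a ≢ b → b ≢ c →
                 proj₁ a ≡ proj₁ b → block b ≡ block c → proj₁ c ≡ proj₁ d → block d ≢ block a
    -- The points of `b` and `c` are distinct and lie in the blocks of both `a` and `b`. These
    -- blocks are therefore equal, although `a` and `b` are different vertices of one copy.
    no-square′ a b c d a≢b b≢c ab bc cd da = separated′ a b a≢b ab
      (unique S (λ eq → separated′ b c b≢c eq bc)
        (subst (_∈ edge H (block a)) ab (block-sound a))
        (subst (_∈ edge H (block a)) (sym cd) (subst (λ e → proj₁ d ∈ edge H e) da (block-sound d)))
        (block-sound b)
        (subst (λ e → proj₁ c ∈ edge H e) (sym bc) (block-sound c)))

  -- Distinct vertices of one copy lie in different blocks, so clique edges add nothing inside a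
  -- copy.
  same-copy : ∀ {p q} → Adj Γ′ p q → proj₁ p ≡ proj₁ q → Adj G (proj₂ p) (proj₂ q)
  same-copy (inj₁ (_ , a))                   _  = a
  same-copy {p} {q} (inj₂ (p≢q , _ , p∈ , q∈)) eq =
    contradiction (trans p∈ (sym q∈)) (separated isFlags p q p≢q eq)

  same-block : ∀ {p q} → Adj Γ′ p q → proj₁ p ≢ proj₁ q → block p ≡ block q
  same-block (inj₁ (eq , _))          ne = contradiction eq ne
  same-block (inj₂ (_ , _ , p∈ , q∈)) _  = trans p∈ (sym q∈)

  clique : ∀ {p q} → p ≢ q → block p ≡ block q → Adj Γ′ p q
  clique p≢q eq = inj₂ (p≢q , _ , eq , refl)

  -- Any two points lie in a common block, so one clique edge leads from one copy to any other.
  Γ-connected : Fin N → Connected G → Connected Γ′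
  Γ-connected i₀ (w₀ , path) = (i₀ , w₀) , path′
    where
    within : ∀ i w w′ → Star (Adj Γ′) (i , w) (i , w′)
    within i w w′ = gmap (i ,_) (λ a → inj₁ (refl , a)) (path w w′)

    path′ : ∀ p q → Star (Adj Γ′) p q
    path′ (i , w) (j , w′) with i ≟ j
    ... | yes refl = within i w w′
    ... | no i≢j with covered S i≢j
    ... | e , i∈e , j∈e with flag i∈e | flag j∈e
    ... | u , u∈ | u′ , u′∈ =
      within i w u ◅◅ clique (i≢j ∘ cong proj₁) (trans u∈ (sym u′∈)) ◅ within j u′ w′

  Γ-order : ∀ {n′} → HasOrder G n′ → HasOrder Γ′ (N * n′)
  Γ-order G↔n′ = ↔-sym *↔× ↔-∘ (↔-id (Fin N) ×-cong G↔n′)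

  -- A monochromatic cycle either projects to a cycle of `G` or has all its vertices in one clique,
  -- which has only `k` of them.
  Γ-cycleFree : ∀ ℓ .{{_ : NonZero ℓ}} → MonochromaticWalks ℓ → k < ℓ → CycleFree ℓ G → CycleFree ℓ Γ′
  Γ-cycleFree ℓ mono k<ℓ free C = [ in-copy , in-clique ]′ (mono (restrict vertex injective isFlags) step′)
    where
    open Cycle C using (vertex; injective) renaming (adjacent to edges)

    step′ : ClosedWalk ℓ (proj₁ ∘ vertex) (block ∘ vertex)
    step′ i with edges i
    ... | inj₁ (eq , _)          = inj₁ eq
    ... | inj₂ (_ , _ , p∈ , q∈) = inj₂ (trans p∈ (sym q∈))

    in-copy : ¬ Constant (proj₁ ∘ vertex)
    in-copy const = free record
      { vertex    = proj₂ ∘ vertex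
      ; injective = λ eq → injective (cong₂ _,_ (const _ _) eq)
      ; adjacent  = λ i → same-copy (edges i) (const _ _)
      }

    in-clique : ¬ Constant (block ∘ vertex)
    in-clique const = <⇒≱ k<ℓ (bound ℓ vertex injective const)
      where
      -- Generalised over `x` so that `ℓ` can be split: the successor case has a first vertex, whose
      -- block contains all the points, and these points determine the vertices.
      bound : ∀ ℓ (x : Fin ℓ → V Γ′) → Injective _≡_ _≡_ x → Constant (block ∘ x) → ℓ ≤ k
      bound zero    _ _   _     = z≤n
      bound (suc ℓ) x inj const = injective⇒≤ {f = proj₁ ∘ index} λ {i} {j} eq → inj (same i j
        (trans (sym (proj₂ (index i))) (trans (cong (at L) eq) (proj₂ (index j)))))
        where
        L = Listing-edge (block (x zero))

        index : ∀ i → ∃[ j ] at L j ≡ proj₁ (x i)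
        index i = at-complete L (subst (λ e → proj₁ (x i) ∈ edge H e) (const i zero) (block-sound (x i)))

        same : ∀ i j → proj₁ (x i) ≡ proj₁ (x j) → x i ≡ x j
        same i j eq with x i | x j | const i j
        same i j refl | _ , _ | _ , _ | b = cong (_ ,_) (block-injective b)

-- Links in Γ(G,H)

module ΓLink {m N n} (G : Graph) (numbering : HasOrder G n)
             (S : SteinerSystem (suc m) N) (enum : Enumeration (hypergraph S) n)
             {s} (i : Fin N) (w : V G) (ℒ : LinkListing G w (s ⊙ K m)) where

  open Steiner S
  open ΓProperties G numbering S enum

  e : Fin (size H)
  e = block (i , w)

  others : Listing (Fin m) (λ j → j ∈ edge H e × j ≢ i)
  others = without (block-sound (i , w)) (Listing-edge e)

  flag-others : ∀ b → ∃[ w′ ] block (at others b , w′) ≡ e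
  flag-others b = flag (proj₁ (at-sound others b))

  -- Component `zero` is the new one, the rest of the clique through `(i , w)`; the components
  -- `suc a` are those of the link of `w` in `G`.
  neighbour : V (suc s ⊙ K m) → V Γ′
  neighbour (zero  , b) = at others b , proj₁ (flag-others b)
  neighbour (suc a , b) = i , at (listing ℒ) (a , b)

  neighbour-injective : Injective _≡_ _≡_ neighbour
  neighbour-injective {zero , b} {zero , b′} eq = cong (zero ,_) (at-injective others (cong proj₁ eq))
  neighbour-injective {zero , b} {suc _ , _} eq = contradiction (cong proj₁ eq) (proj₂ (at-sound others b))
  neighbour-injective {suc _ , _} {zero , b} eq = contradiction (sym (cong proj₁ eq)) (proj₂ (at-sound others b))
  neighbour-injective {suc _ , _} {suc _ , _} eq with at-injective (listing ℒ) (cong-proj₂ eq)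
    where
    cong-proj₂ : ∀ {u u′ : V G} → (i , u) ≡ (i , u′) → u ≡ u′
    cong-proj₂ refl = refl
  ... | refl = refl

  neighbour-sound : ∀ p → Adj Γ′ (i , w) (neighbour p)
  neighbour-sound (zero  , b) = clique (proj₂ (at-sound others b) ∘ sym ∘ cong proj₁) (sym (proj₂ (flag-others b)))
  neighbour-sound (suc a , b) = inj₁ (refl , at-sound (listing ℒ) (a , b))

  neighbour-complete : ∀ {q} → Adj Γ′ (i , w) q → ∃[ p ] neighbour p ≡ q
  -- A neighbour in the same copy comes from the link in `G`; any other has the same block and a
  -- different point.
  neighbour-complete {j , u} adj with j ≟ i
  ... | yes refl with at-complete (listing ℒ) (same-copy adj refl)
  ...   | (a , b) , eq = (suc a , b) , cong (i ,_) eq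
  neighbour-complete {j , u} adj | no j≢i with same-block adj (j≢i ∘ sym)
  ...   | eq with at-complete others (subst (λ e → j ∈ edge H e) (sym eq) (block-sound (j , u)) , j≢i)
  ...     | b , refl = (zero , b) , cong (j ,_) (block-injective (trans (proj₂ (flag-others b)) eq))

  -- Adjacency would force the block e on a neighbour of (i , w) in its own copy.
  no-mixed : ∀ a b b′ → ¬ Adj Γ′ (neighbour (suc a , b)) (neighbour (zero , b′))
  no-mixed a b b′ adj = separated isFlags (i , w) (neighbour (suc a , b))
    (λ { eq → adj-irrefl Γ′ eq (neighbour-sound (suc a , b)) }) refl
    (sym (trans (same-block adj (proj₂ (at-sound others b′) ∘ sym)) (proj₂ (flag-others b′))))

  neighbour-adjacent : ∀ p q → Adj Γ′ (neighbour p) (neighbour q) ⇔ Adj (suc s ⊙ K m) p q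
  neighbour-adjacent (zero , b) (zero , b′) = mk⇔
    (λ adj → refl , λ { refl → adj-irrefl Γ′ refl adj })
    (λ (_ , b≢b′) → clique (b≢b′ ∘ at-injective others ∘ cong proj₁)
                           (trans (proj₂ (flag-others b)) (sym (proj₂ (flag-others b′)))))
  neighbour-adjacent (zero , b) (suc a , b′) = mk⇔
    (λ adj → contradiction (adj-sym Γ′ adj) (no-mixed a b′ b)) (λ ())
  neighbour-adjacent (suc a , b) (zero , b′) = mk⇔
    (λ adj → contradiction adj (no-mixed a b b′)) (λ ())
  neighbour-adjacent (suc a , b) (suc a′ , b′) = mk⇔
    (λ adj → let eq , ne = Equivalence.to (adjacent ℒ (a , b) (a′ , b′)) (same-copy adj refl)
             in cong suc eq , ne)
    (λ (eq , ne) → inj₁ (refl , Equivalence.from (adjacent ℒ (a , b) (a′ , b′)) (suc-injective eq , ne)))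

  Γ-link : LinkListing Γ′ (i , w) (suc s ⊙ K m)
  Γ-link = record
    { listing = record
        { at           = neighbour
        ; at-injective = neighbour-injective
        ; at-sound     = neighbour-sound
        ; at-complete  = neighbour-complete
        }
    ; adjacent = neighbour-adjacent
    }

-- Arithmetic of the numbers v_j

-- The separately defined `v k 1` fits the general formula with an empty product.
v-suc : ∀ k i → v k (suc i) ≡ k * (k ∸ 1) * ∏v k i + 1
v-suc k (suc i) = refl
v-suc k zero    = cong (_+ 1) (begin
  k ^ 2 ∸ k            ≡⟨ cong₂ _∸_ (cong (k *_) (*-identityʳ k)) (sym (*-identityʳ k)) ⟩
  k * k ∸ k * 1        ≡⟨ *-distribˡ-∸ k k 1 ⟨
  k * (k ∸ 1)          ≡⟨ *-identityʳ _ ⟨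
  k * (k ∸ 1) * 1      ∎)
  where open ≡-Reasoning

-- Says that the degree (v - 1)/(k - 1) of the next Steiner system is `k * ∏v k i`, the order of the
-- graph it is combined with.
v-regular : ∀ m i → let k = suc m in v k (suc i) ≡ suc (k * ∏v k i * m)
v-regular m i = trans (v-suc k i) (trans (+-comm _ 1) (cong suc (begin
  k * m * ∏v k i      ≡⟨ *-assoc k m (∏v k i) ⟩
  k * (m * ∏v k i)    ≡⟨ cong (k *_) (*-comm m (∏v k i)) ⟩
  k * (∏v k i * m)    ≡⟨ *-assoc k (∏v k i) m ⟨
  k * ∏v k i * m      ∎)))
  where
  k = suc m
  open ≡-Reasoning

-- Induction along the sequence S_t(k)

module _ (m : ℕ) (H : (i : ℕ) .{{_ : NonZero i}} → SteinerSystem (suc (suc m)) (v (suc (suc m)) i)) where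

  private
    k : ℕ
    k = suc (suc m)

  S-order : ∀ {i G} → IsS k H (suc i) G → HasOrder G (k * ∏v k i)
  S-order base = subst (λ n → Fin k ↔ Fin n) (sym (*-identityʳ k)) (↔-id (Fin k))
  S-order {suc i} (step {G = G} s numbering enum) = subst (HasOrder (Γ G numbering _ enum))
    (trans (*-comm (v k (suc i)) (k * ∏v k i)) (*-assoc k (∏v k i) (v k (suc i))))
    (ΓProperties.Γ-order G numbering (H (suc i)) enum (S-order s))

  S-connected : ∀ {i G} → IsS k H i G → Connected G
  S-connected base = K-connected (suc m)
  S-connected (step {i} {G = G} s numbering enum) =
    ΓProperties.Γ-connected G numbering (H (suc i)) enum
      -- By `v-regular` the number of points is a successor, so there is a point to start from.
      (subst Fin (sym (v-regular (suc m) i)) zero) (S-connected s)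

  S-link : ∀ {i G} → IsS k H i G → ∀ x → LinkListing G x (i ⊙ K (suc m))
  S-link base x = K-link (suc m) x
  S-link (step {i} {G = G} s numbering enum) (j , w) =
    ΓLink.Γ-link G numbering (H (suc i)) enum j w (S-link s w)

  S-cycleFree : ∀ {i G} ℓ .{{_ : NonZero ℓ}} → MonochromaticWalks ℓ → k < ℓ → IsS k H i G → CycleFree ℓ G
  S-cycleFree ℓ mono k<ℓ base = K-cycleFree ℓ k<ℓ
  S-cycleFree ℓ mono k<ℓ (step {i} {G = G} s numbering enum) =
    ΓProperties.Γ-cycleFree G numbering (H (suc i)) enum ℓ mono k<ℓ (S-cycleFree ℓ mono k<ℓ s)

  -- The order given by `S-order` is exactly the degree that `enumeration` obtains from `v-regular`,
  -- so `step` can always be applied.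
  S-exists : ∀ i → ∃[ G ] IsS k H (suc i) G
  S-exists zero    = K k , base
  S-exists (suc i) with S-exists i
  ... | G , s = _ , step s (S-order s) (enumeration (v-regular (suc m) i) (H (suc i)))

theorem16 : (k : ℕ) → k ≡ 3 ⊎ k ≡ 4 ⊎ k ≡ 5 →
    (H : (i : ℕ) .{{_ : NonZero i}} → SteinerSystem k (v k i)) →
    (t : ℕ) → t ≥ 1 →
    (∃[ G ] IsS k H t G) ×
    (∀ G → IsS k H t G →
    Connected G ×
    HasOrder G (k * ∏v k (t ∸ 1)) ×
    HasConstantLink G (t ⊙ K (k ∸ 1)) ×
    (k ≡ 3 → CycleFree 4 G × CycleFree 5 G) ×
    (k ≡ 4 → CycleFree 5 G))
theorem16 (suc (suc m)) _ H (suc i) _ = S-exists m H i , λ G s →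
  S-connected m H s ,
  S-order m H s ,
  (λ x → LinkListing⇒≅ (S-link m H s x)) ,
  -- The bound `k < ℓ` excludes cycles inside a clique: it allows lengths 4 and 5 for k = 3, but
  -- only length 5 for k = 4, as the complete graph on 4 vertices contains a 4-cycle.
  (λ { refl → S-cycleFree m H 4 monochromatic₄ (n<1+n 3) s
            , S-cycleFree m H 5 monochromatic₅ (s≤s (s≤s (s≤s (s≤s z≤n)))) s }) ,
  (λ { refl → S-cycleFree m H 5 monochromatic₅ (n<1+n 4) s })
theorem16 0 (inj₂ (inj₁ ()))
theorem16 1 (inj₂ (inj₁ ()))
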